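{- Let $R$ be an arbitrary commutative ring with $1$ in which $2$ is not invertible ($1/2\notin R$), and let $G$ be a large subgroup of the simply connected Chevalley group $G_{sc}(\mathbf C_2,R)$, where $\mathbf C_2=\{\pm e_1\pm e_2,\pm2e_1,\pm2e_2\}$. Then the subgroup $Y_{e_1+e_2}=\{x_{e_1+e_2}(t)\,x_{2e_2}(t)\mid t\in R\}$ is Diophantine in $G$.
   Context: Let $\mathcal L$ be the complex semisimple Lie algebra with root system $\Phi$, with Chevalley basis $\{h_i;x_\alpha\}$, and let $\pi$ be a faithful finite-dimensional representation of $\mathcal L$ with weight lattice $\Lambda_\pi$ (a lattice between the root lattice and the lattice of all weights $\Lambda_{sc}$). $G_\pi(\Phi,R)$ denotes the Chevalley group of type $(\Phi,\Lambda_\pi)$ over $R$, i.e. the group of $R$-points of the Chevalley--Demazure group scheme, realized as the subgroup of $\mathrm{SL}_n(R)$, $n=\dim\pi$, given by polynomial equations with integer coefficients in the matrix entries; $G_{sc}(\Phi,R)$ is the simply connected one, with $\Lambda_\pi=\Lambda_{sc}$. For $\alpha\in\Phi$, $t\in R$, $x_\alpha(t)=\exp(t\pi(x_\alpha))$ is the elementary root unipotent; $E_\pi(\Phi,R)$ is the subgroup generated by all $x_\alpha(t)$; a subgroup of $G_\pi(\Phi,R)$ is large if it contains $E_\pi(\Phi,R)$. A subset $H$ of a group $G$ is Diophantine in $G$ if it is definable in $G$ by a formula $\exists y_1\dots\exists y_n\bigwedge_{i=1}^k w_i(x,y_1,\dots,y_n)=1$, where each $w_i$ is a group word in $x,y_1,\dots,y_n$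 and constants from $G$. -}

module Defs where

open import Level using (Level; _⊔_; suc; 0ℓ)
open import Algebra.Bundles using (Group; CommutativeRing)
import Algebra.Definitions.RawMonoid as RawMonoidDefs
import Algebra.Properties.Semiring.Sum as SumProperties
open import Data.Bool.Base using (if_then_else_)
open import Data.Fin.Base using (Fin; remQuot)
open import Data.Fin.Patterns using (0F; 1F; 2F; 3F)
open import Data.Fin.Properties using (_≟_; all?; any?)
open import Data.Integer.Base as ℤ using (ℤ; +_; -[1+_]; 0ℤ; 1ℤ; -1ℤ; _◃_)
import Data.Integer.Properties as ℤ
open import Data.Nat.Base as ℕ using (ℕ)
open import Data.Product.Base using (Σ; ∃-syntax; _×_; _,_; proj₁; uncurry)
import Data.Product.Properties as Product
open import Data.Rational.Base using (0ℚ)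
import Data.Rational.Properties as ℚ
open import Data.Sign.Base using (Sign; opposite)
open import Data.Sum.Base using (_⊎_; inj₁; inj₂; [_,_]′)
open import Data.Vec.Base using (tabulate)
open import Data.Vec.Functional using (Vector; _∷_)
open import Function.Bundles using (_⇔_)
open import Relation.Binary.PropositionalEquality as ≡ using (_≡_; _≢_)
open import Relation.Nullary.Decidable using (Dec; does; from-yes; ¬?; _⊎-dec_; _→-dec_; _×-dec_; map′)
open import Relation.Nullary.Negation using (contradiction)
open import Relation.Unary using (Pred; _⊆_)
open import Tactic.RingSolver.Core.Expression using (Expr; module Eval)

private
  variable
    a c ℓ p q : Level

------------------------------------------------------------------------
-- Diophantine subsets of a group

infixl 7 _·_
infix  8 _⁻¹

data Word (A : Set a) (n : ℕ) : Set a where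
  const : A → Word A n
  var   : Fin n → Word A n
  one   : Word A n
  _·_   : Word A n → Word A n → Word A n
  _⁻¹   : Word A n → Word A n

module _ (𝔾 : Group c ℓ) where

  private module 𝔾 = Group 𝔾

  evalWord : ∀ {n} → Word 𝔾.Carrier n → Vector 𝔾.Carrier n → 𝔾.Carrier
  evalWord (const g) ρ = g
  evalWord (var i)   ρ = ρ i
  evalWord one       ρ = 𝔾.ε
  evalWord (v · w)   ρ = evalWord v ρ 𝔾.∙ evalWord w ρ
  evalWord (w ⁻¹)    ρ = evalWord w ρ 𝔾.⁻¹

  Diophantine : Pred 𝔾.Carrier p → Set (c ⊔ ℓ ⊔ p)
  Diophantine H =
    ∃[ n ] ∃[ k ] Σ (Fin k → Word 𝔾.Carrier (ℕ.suc n)) λ w →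
      ∀ x → H x ⇔ (Σ (Vector 𝔾.Carrier n) λ y → ∀ i → evalWord (w i) (x ∷ y) 𝔾.≈ 𝔾.ε)

------------------------------------------------------------------------
-- Subgroups

  record Subgroup (p : Level) : Set (c ⊔ ℓ ⊔ suc p) where
    field
      member : Pred 𝔾.Carrier p
      resp   : ∀ {g h} → g 𝔾.≈ h → member g → member h
      ε∈     : member 𝔾.ε
      ∙∈     : ∀ {g h} → member g → member h → member (g 𝔾.∙ h)
      ⁻¹∈    : ∀ {g} → member g → member (g 𝔾.⁻¹)

    group : Group (c ⊔ p) ℓ
    group = record
      { Carrier = Σ 𝔾.Carrier member
      ; _≈_     = λ g h → proj₁ g 𝔾.≈ proj₁ h
      ; _∙_     = λ (g , g∈) (h , h∈) → g 𝔾.∙ h , ∙∈ g∈ h∈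
      ; ε       = 𝔾.ε , ε∈
      ; _⁻¹     = λ (g , g∈) → g 𝔾.⁻¹ , ⁻¹∈ g∈
      ; isGroup = record
        { isMonoid = record
          { isSemigroup = record
            { isMagma = record
              { isEquivalence = record { refl = 𝔾.refl ; sym = 𝔾.sym ; trans = 𝔾.trans }
              ; ∙-cong = 𝔾.∙-cong
              }
            ; assoc = λ _ _ _ → 𝔾.assoc _ _ _
            }
          ; identity = (λ _ → 𝔾.identityˡ _) , (λ _ → 𝔾.identityʳ _)
          }
        ; inverse = (λ _ → 𝔾.inverseˡ _) , (λ _ → 𝔾.inverseʳ _)
        ; ⁻¹-cong = 𝔾.⁻¹-cong
        }
      }

  data Generated (S : Pred 𝔾.Carrier p) : Pred 𝔾.Carrier (c ⊔ ℓ ⊔ p) where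
    gen  : ∀ {g} → S g → Generated S g
    resp : ∀ {g h} → g 𝔾.≈ h → Generated S g → Generated S h
    ε∈   : Generated S 𝔾.ε
    ∙∈   : ∀ {g h} → Generated S g → Generated S h → Generated S (g 𝔾.∙ h)
    ⁻¹∈  : ∀ {g} → Generated S g → Generated S (g 𝔾.⁻¹)

------------------------------------------------------------------------
-- Square matrices and the general linear group

module Matrices (R : CommutativeRing c ℓ) where

  open CommutativeRing R
  open SumProperties semiring using (sum-syntax; sum-cong-≋; ∑-comm; *-distribˡ-sum; *-distribʳ-sum; sum-replicate-zero)
  open import Relation.Binary.Reasoning.Setoid setoid

  infix  4 _≋_
  infixl 6 _+ᴹ_ _-ᴹ_
  infixl 7 _*ᴹ_
  infixr 7 _·ᴹ_
  infix  9 _ᵀ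

  Matrix : ℕ → Set c
  Matrix n = Fin n → Fin n → Carrier

  _≋_ : ∀ {n} → Matrix n → Matrix n → Set ℓ
  A ≋ B = ∀ i j → A i j ≈ B i j

  0ᴹ 1ᴹ : ∀ {n} → Matrix n
  0ᴹ i j = 0#
  1ᴹ i j = if does (i ≟ j) then 1# else 0#

  _+ᴹ_ _-ᴹ_ _*ᴹ_ ⁅_,_⁆ : ∀ {n} → Matrix n → Matrix n → Matrix n
  (A +ᴹ B) i j = A i j + B i j
  (A -ᴹ B) i j = A i j - B i j
  _*ᴹ_ {n} A B i j = ∑[ k < n ] (A i k * B k j)
  ⁅ A , B ⁆ = A *ᴹ B -ᴹ B *ᴹ A

  _·ᴹ_ : ∀ {n} → Carrier → Matrix n → Matrix n
  (t ·ᴹ A) i j = t * A i j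

  _ᵀ : ∀ {n} → Matrix n → Matrix n
  (A ᵀ) i j = A j i

  ∑-zero : ∀ {n} (f : Vector Carrier n) → (∀ k → f k ≈ 0#) → ∑[ k < n ] f k ≈ 0#
  ∑-zero {n} f f≈0 = trans (sum-cong-≋ f≈0) (sum-replicate-zero n)

  ∑-1ᴹˡ : ∀ {n} (i : Fin n) (f : Vector Carrier n) → ∑[ k < n ] (1ᴹ i k * f k) ≈ f i
  ∑-1ᴹˡ Fin.zero f = begin
    1# * f 0F + _  ≈⟨ +-cong (*-identityˡ _) (∑-zero (λ k → 0# * f (Fin.suc k)) (λ _ → zeroˡ _)) ⟩
    f 0F + 0#      ≈⟨ +-identityʳ _ ⟩
    f 0F           ∎
  ∑-1ᴹˡ (Fin.suc i) f = begin
    0# * f 0F + _  ≈⟨ +-cong (zeroˡ _) (∑-1ᴹˡ i (λ k → f (Fin.suc k))) ⟩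
    0# + _         ≈⟨ +-identityˡ _ ⟩
    f (Fin.suc i)  ∎

  1ᴹ-sym : ∀ {n} (i j : Fin n) → 1ᴹ i j ≡ 1ᴹ j i
  1ᴹ-sym Fin.zero    Fin.zero    = ≡.refl
  1ᴹ-sym Fin.zero    (Fin.suc j) = ≡.refl
  1ᴹ-sym (Fin.suc i) Fin.zero    = ≡.refl
  1ᴹ-sym (Fin.suc i) (Fin.suc j) = 1ᴹ-sym i j

  ∑-1ᴹʳ : ∀ {n} (j : Fin n) (f : Vector Carrier n) → ∑[ k < n ] (f k * 1ᴹ k j) ≈ f j
  ∑-1ᴹʳ j f = trans
    (sum-cong-≋ λ k → trans (*-comm _ _) (*-congʳ (reflexive (1ᴹ-sym k j))))
    (∑-1ᴹˡ j f)

  *ᴹ-congˡ : ∀ {n} (A : Matrix n) {B B′ : Matrix n} → B ≋ B′ → A *ᴹ B ≋ A *ᴹ B′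
  *ᴹ-congˡ A B≋B′ i j = sum-cong-≋ λ k → *-congˡ (B≋B′ k j)

  *ᴹ-congʳ : ∀ {n} (B : Matrix n) {A A′ : Matrix n} → A ≋ A′ → A *ᴹ B ≋ A′ *ᴹ B
  *ᴹ-congʳ B A≋A′ i j = sum-cong-≋ λ k → *-congʳ (A≋A′ i k)

  *ᴹ-assoc : ∀ {n} (A B C : Matrix n) → (A *ᴹ B) *ᴹ C ≋ A *ᴹ (B *ᴹ C)
  *ᴹ-assoc {n} A B C i j = begin
    ∑[ k < n ] ((∑[ l < n ] (A i l * B l k)) * C k j)  ≈⟨ sum-cong-≋ (λ k → *-distribʳ-sum (C k j) (λ l → A i l * B l k)) ⟩
    ∑[ k < n ] ∑[ l < n ] (A i l * B l k * C k j)      ≈⟨ ∑-comm (λ k l → A i l * B l k * C k j) ⟩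
    ∑[ l < n ] ∑[ k < n ] (A i l * B l k * C k j)      ≈⟨ sum-cong-≋ (λ l → sum-cong-≋ (λ k → *-assoc (A i l) (B l k) (C k j))) ⟩
    ∑[ l < n ] ∑[ k < n ] (A i l * (B l k * C k j))    ≈⟨ sum-cong-≋ (λ l → sym (*-distribˡ-sum (A i l) (λ k → B l k * C k j))) ⟩
    ∑[ l < n ] (A i l * (∑[ k < n ] (B l k * C k j)))  ∎

  record Invertible (n : ℕ) : Set (c ⊔ ℓ) where
    field
      mat     : Matrix n
      inv     : Matrix n
      mat*inv : mat *ᴹ inv ≋ 1ᴹ
      inv*mat : inv *ᴹ mat ≋ 1ᴹ

  open Invertible public

  private
    cancel : ∀ {n} (A B B′ A′ : Matrix n) → B *ᴹ B′ ≋ 1ᴹ → A *ᴹ A′ ≋ 1ᴹ →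
             (A *ᴹ B) *ᴹ (B′ *ᴹ A′) ≋ 1ᴹ
    cancel A B B′ A′ BB′ AA′ i j = begin
      ((A *ᴹ B) *ᴹ (B′ *ᴹ A′)) i j  ≈⟨ *ᴹ-assoc A B (B′ *ᴹ A′) i j ⟩
      (A *ᴹ (B *ᴹ (B′ *ᴹ A′))) i j  ≈⟨ *ᴹ-congˡ A (λ k l → sym (*ᴹ-assoc B B′ A′ k l)) i j ⟩
      (A *ᴹ ((B *ᴹ B′) *ᴹ A′)) i j  ≈⟨ *ᴹ-congˡ A (*ᴹ-congʳ A′ BB′) i j ⟩
      (A *ᴹ (1ᴹ *ᴹ A′)) i j         ≈⟨ *ᴹ-congˡ A (λ k l → ∑-1ᴹˡ k (λ m → A′ m l)) i j ⟩
      (A *ᴹ A′) i j                 ≈⟨ AA′ i j ⟩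
      1ᴹ i j                        ∎

    inv-unique : ∀ {n} (A B A′ B′ : Matrix n) → A ≋ B → A′ *ᴹ A ≋ 1ᴹ → B *ᴹ B′ ≋ 1ᴹ → A′ ≋ B′
    inv-unique A B A′ B′ A≋B A′A BB′ i j = begin
      A′ i j                   ≈⟨ ∑-1ᴹʳ j (A′ i) ⟨
      (A′ *ᴹ 1ᴹ) i j           ≈⟨ *ᴹ-congˡ A′ BB′ i j ⟨
      (A′ *ᴹ (B *ᴹ B′)) i j    ≈⟨ *ᴹ-assoc A′ B B′ i j ⟨
      ((A′ *ᴹ B) *ᴹ B′) i j    ≈⟨ *ᴹ-congʳ B′ (*ᴹ-congˡ A′ A≋B) i j ⟨
      ((A′ *ᴹ A) *ᴹ B′) i j    ≈⟨ *ᴹ-congʳ B′ A′A i j ⟩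
      (1ᴹ *ᴹ B′) i j           ≈⟨ ∑-1ᴹˡ i (λ m → B′ m j) ⟩
      B′ i j                   ∎

  GL : ℕ → Group (c ⊔ ℓ) ℓ
  GL n = record
    { Carrier = Invertible n
    ; _≈_     = λ g h → mat g ≋ mat h
    ; _∙_     = λ g h → record
      { mat     = mat g *ᴹ mat h
      ; inv     = inv h *ᴹ inv g
      ; mat*inv = cancel (mat g) (mat h) (inv h) (inv g) (mat*inv h) (mat*inv g)
      ; inv*mat = cancel (inv h) (inv g) (mat g) (mat h) (inv*mat g) (inv*mat h)
      }
    ; ε       = record
      { mat = 1ᴹ ; inv = 1ᴹ
      ; mat*inv = λ i j → ∑-1ᴹˡ i (λ k → 1ᴹ k j)
      ; inv*mat = λ i j → ∑-1ᴹˡ i (λ k → 1ᴹ k j)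
      }
    ; _⁻¹     = λ g → record
      { mat = inv g ; inv = mat g ; mat*inv = inv*mat g ; inv*mat = mat*inv g }
    ; isGroup = record
      { isMonoid = record
        { isSemigroup = record
          { isMagma = record
            { isEquivalence = record
              { refl  = λ _ _ → refl
              ; sym   = λ A≋B i j → sym (A≋B i j)
              ; trans = λ A≋B B≋C i j → trans (A≋B i j) (B≋C i j)
              }
            ; ∙-cong = λ {g} {g′} {h} {h′} g≈g′ h≈h′ i j →
                trans (*ᴹ-congʳ (mat h) g≈g′ i j) (*ᴹ-congˡ (mat g′) h≈h′ i j)
            }
          ; assoc = λ g h k → *ᴹ-assoc (mat g) (mat h) (mat k)
          }
        ; identity = (λ g i j → ∑-1ᴹˡ i (λ k → mat g k j)) , (λ g i j → ∑-1ᴹʳ j (mat g i))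
        }
      ; inverse = inv*mat , mat*inv
      ; ⁻¹-cong = λ {g} {h} g≈h → inv-unique (mat g) (mat h) (inv g) (inv h) g≈h (inv*mat g) (mat*inv h)
      }
    }

------------------------------------------------------------------------
-- The root system C₂ = {±e₁±e₂, ±2e₁, ±2e₂}

infixl 6 _⊹_
infix  8 ⊝_

data Root : Set where
  short : Sign → Sign → Root
  long  : Fin 2 → Sign → Root

⊝_ : Root → Root
⊝ short s t = short (opposite s) (opposite t)
⊝ long i s  = long i (opposite s)

e₁+e₂ 2e₂ : Root
e₁+e₂ = short Sign.+ Sign.+
2e₂   = long 1F Sign.+

allRoots? : {P : Root → Set p} → (∀ α → Dec (P α)) → Dec (∀ α → P α)
allRoots? {P = P} P? = map′ to from
  (signs? (λ s → signs? λ t → P? (short s t)) ×-dec all? λ i → signs? λ s → P? (long i s))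
  where
  signs? : {Q : Sign → Set q} → (∀ s → Dec (Q s)) → Dec (∀ s → Q s)
  signs? Q? = map′ (λ { (p , m) Sign.+ → p ; (p , m) Sign.- → m }) (λ f → f Sign.+ , f Sign.-)
                   (Q? Sign.+ ×-dec Q? Sign.-)
  to : (∀ s t → P (short s t)) × (∀ i s → P (long i s)) → ∀ α → P α
  to (f , g) (short s t) = f s t
  to (f , g) (long i s)  = g i s
  from : (∀ α → P α) → (∀ s t → P (short s t)) × (∀ i s → P (long i s))
  from h = (λ s t → h (short s t)) , λ i s → h (long i s)

_⊹_ : ℤ × ℤ → ℤ × ℤ → ℤ × ℤ
(a , b) ⊹ (c , d) = a ℤ.+ c , b ℤ.+ d

⟨_,_⟩ : ℤ × ℤ → ℤ × ℤ → ℤ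
⟨ (a , b) , (c , d) ⟩ = a ℤ.* c ℤ.+ b ℤ.* d

-- A multiple of eᵢ, i = 1, 2.
axis : Fin 2 → ℤ → ℤ × ℤ
axis 0F m = m , 0ℤ
axis 1F m = 0ℤ , m

vec : Root → ℤ × ℤ
vec (short s t) = s ◃ 1 , t ◃ 1
vec (long i s)  = axis i (s ◃ 2)

-- α∨ = 2α / (α , α)
coroot : Root → ℤ × ℤ
coroot (short s t) = s ◃ 1 , t ◃ 1
coroot (long i s)  = axis i (s ◃ 1)

------------------------------------------------------------------------
-- Chevalley bases of the symplectic Lie algebra 𝔰𝔭₄ in its natural
-- representation.  Its weights ±e₁, ±e₂ span the lattice of all weights
-- ℤe₁ ⊕ ℤe₂ of C₂, so this representation gives the simply connected group.

module ℤᴹ = Matrices ℤ.+-*-commutativeRing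
open ℤᴹ using (_≋_; _+ᴹ_; _*ᴹ_; _·ᴹ_; _ᵀ; 0ᴹ; 1ᴹ; ⁅_,_⁆)

weight : Fin 4 → ℤ × ℤ
weight 0F = 1ℤ , 0ℤ
weight 1F = 0ℤ , 1ℤ
weight 2F = 0ℤ , -1ℤ
weight 3F = -1ℤ , 0ℤ

-- The alternating form whose isometry algebra is 𝔰𝔭₄.
J : ℤᴹ.Matrix 4
J 0F 3F = 1ℤ
J 1F 2F = 1ℤ
J 2F 1F = -1ℤ
J 3F 0F = -1ℤ
J _  _  = 0ℤ

cartan : ℤ × ℤ → ℤᴹ.Matrix 4
cartan h i j = ⟨ weight i , h ⟩ ℤ.* 1ᴹ i j

-- A Chevalley basis {h_i ; e_α} of 𝔰𝔭₄ whose Cartan subalgebra consists of the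
-- diagonal matrices and which preserves the lattice ℤ⁴; the h_i are the
-- matrices cartan (coroot αᵢ) for simple roots αᵢ.
record ChevalleyBasis : Set where
  field
    e           : Root → ℤᴹ.Matrix 4
    e∈𝔰𝔭        : ∀ α → e α ᵀ *ᴹ J +ᴹ J *ᴹ e α ≋ 0ᴹ
    root-vector : ∀ α β → ⁅ cartan (coroot β) , e α ⁆ ≋ ⟨ vec α , coroot β ⟩ ·ᴹ e α
    coroots     : ∀ α → ⁅ e α , e (⊝ α) ⁆ ≋ cartan (coroot α)
    constants   : ∀ α β γ → vec γ ≡ vec α ⊹ vec β →
                  ∃[ N ] ⁅ e α , e β ⁆ ≋ N ·ᴹ e γ × ⁅ e (⊝ α) , e (⊝ β) ⁆ ≋ (ℤ.- N) ·ᴹ e (⊝ γ)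

standardBasis : ChevalleyBasis
standardBasis = record
  { e           = e
  ; e∈𝔰𝔭        = from-yes (allRoots? λ α → (e α ᵀ *ᴹ J +ᴹ J *ᴹ e α) ≋? 0ᴹ)
  ; root-vector = from-yes (allRoots? λ α → allRoots? λ β →
                    ⁅ cartan (coroot β) , e α ⁆ ≋? (⟨ vec α , coroot β ⟩ ·ᴹ e α))
  ; coroots     = from-yes (allRoots? λ α → ⁅ e α , e (⊝ α) ⁆ ≋? cartan (coroot α))
  ; constants   = λ α β γ γ≡α+β → ∃N {α} {β} {γ} (from-yes constants? α β γ γ≡α+β)
  }
  where
  _≋?_ : (A B : ℤᴹ.Matrix 4) → Dec (A ≋ B)
  A ≋? B = all? λ i → all? λ j → A i j ℤ.≟ B i j

  e : Root → ℤᴹ.Matrix 4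
  e (long 0F Sign.+)       0F 3F = 1ℤ
  e (long 0F Sign.-)       3F 0F = 1ℤ
  e (long 1F Sign.+)       1F 2F = 1ℤ
  e (long 1F Sign.-)       2F 1F = 1ℤ
  e (short Sign.+ Sign.+)  0F 2F = 1ℤ
  e (short Sign.+ Sign.+)  1F 3F = 1ℤ
  e (short Sign.- Sign.-)  2F 0F = 1ℤ
  e (short Sign.- Sign.-)  3F 1F = 1ℤ
  e (short Sign.+ Sign.-)  0F 1F = 1ℤ
  e (short Sign.+ Sign.-)  2F 3F = -1ℤ
  e (short Sign.- Sign.+)  1F 0F = 1ℤ
  e (short Sign.- Sign.+)  3F 2F = -1ℤ
  e _ _ _ = 0ℤ

  Constant : Root → Root → Root → ℤ → Set
  Constant α β γ N = ⁅ e α , e β ⁆ ≋ N ·ᴹ e γ × ⁅ e (⊝ α) , e (⊝ β) ⁆ ≋ (ℤ.- N) ·ᴹ e (⊝ γ)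

  candidate : Fin 4 → ℤ
  candidate 0F = + 1
  candidate 1F = + 2
  candidate 2F = -[1+ 0 ]
  candidate 3F = -[1+ 1 ]

  constants? = allRoots? λ α → allRoots? λ β → allRoots? λ γ →
    Product.≡-dec ℤ._≟_ ℤ._≟_ (vec γ) (vec α ⊹ vec β) →-dec any? λ n →
      (⁅ e α , e β ⁆ ≋? (candidate n ·ᴹ e γ)) ×-dec
      (⁅ e (⊝ α) , e (⊝ β) ⁆ ≋? ((ℤ.- candidate n) ·ᴹ e (⊝ γ)))

  ∃N : ∀ {α β γ} → ∃[ n ] Constant α β γ (candidate n) → ∃[ N ] Constant α β γ N
  ∃N (n , c) = candidate n , c

module _ (𝓑 : ChevalleyBasis) where

  open ChevalleyBasis 𝓑

  private
    shift : Root → Fin 4 → Fin 4 → ℤ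
    shift α i j = ⟨ weight i , coroot α ⟩ ℤ.- ⟨ weight j , coroot α ⟩ ℤ.- ⟨ vec α , coroot α ⟩

    shift*e : ∀ α i j → shift α i j ℤ.* e α i j ≡ 0ℤ
    shift*e α i j = begin
      (wᵢ ℤ.- wⱼ ℤ.- m) ℤ.* x                                      ≡⟨ expand wᵢ wⱼ m x ⟩
      (wᵢ ℤ.* x ℤ.- x ℤ.* wⱼ) ℤ.- m ℤ.* x                          ≡⟨ ≡.cong (ℤ._- m ℤ.* x) (≡.sym bracket) ⟩
      ⁅ cartan (coroot α) , e α ⁆ i j ℤ.- m ℤ.* x                  ≡⟨ ≡.cong (ℤ._- m ℤ.* x) (root-vector α α i j) ⟩
      m ℤ.* x ℤ.- m ℤ.* x                                          ≡⟨ ℤ.+-inverseʳ (m ℤ.* x) ⟩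
      0ℤ                                                           ∎
      where
      open ≡.≡-Reasoning
      open CommutativeRing ℤ.+-*-commutativeRing using (semiring)
      open SumProperties semiring using (sum-cong-≋; *-distribˡ-sum)
      open import Data.Integer.Tactic.RingSolver using (solve-∀)
      wᵢ = ⟨ weight i , coroot α ⟩
      wⱼ = ⟨ weight j , coroot α ⟩
      m  = ⟨ vec α , coroot α ⟩
      x  = e α i j
      expand : ∀ u v m x → (u ℤ.- v ℤ.- m) ℤ.* x ≡ (u ℤ.* x ℤ.- x ℤ.* v) ℤ.- m ℤ.* x
      expand = solve-∀
      left : (cartan (coroot α) *ᴹ e α) i j ≡ wᵢ ℤ.* x
      left = ≡.trans
        (sum-cong-≋ λ k → ℤ.*-assoc wᵢ (1ᴹ i k) (e α k j))
        (≡.trans (≡.sym (*-distribˡ-sum wᵢ (λ k → 1ᴹ i k ℤ.* e α k j)))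
                 (≡.cong (wᵢ ℤ.*_) (ℤᴹ.∑-1ᴹˡ i (λ k → e α k j))))
      right : (e α *ᴹ cartan (coroot α)) i j ≡ x ℤ.* wⱼ
      right = ≡.trans
        (sum-cong-≋ λ k → ≡.sym (ℤ.*-assoc (e α i k) ⟨ weight k , coroot α ⟩ (1ᴹ k j)))
        (ℤᴹ.∑-1ᴹʳ j (λ k → e α i k ℤ.* ⟨ weight k , coroot α ⟩))
      bracket : ⁅ cartan (coroot α) , e α ⁆ i j ≡ wᵢ ℤ.* x ℤ.- x ℤ.* wⱼ
      bracket = ≡.cong₂ ℤ._-_ left right

    e-zero : ∀ α i j → shift α i j ≢ 0ℤ → e α i j ≡ 0ℤ
    e-zero α i j s≢0 =
      [ (λ s≡0 → contradiction s≡0 s≢0) , (λ x≡0 → x≡0) ]′ (ℤ.i*j≡0⇒i≡0∨j≡0 (shift α i j) (shift*e α i j))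

    shift? : ∀ α → Dec (∀ i k j → shift α i k ≢ 0ℤ ⊎ shift α k j ≢ 0ℤ)
    shift? α = all? λ i → all? λ k → all? λ j →
      ¬? (shift α i k ℤ.≟ 0ℤ) ⊎-dec ¬? (shift α k j ℤ.≟ 0ℤ)

    shift≢0 : ∀ α i k j → shift α i k ≢ 0ℤ ⊎ shift α k j ≢ 0ℤ
    shift≢0 α@(short Sign.+ Sign.+) = from-yes (shift? α)
    shift≢0 α@(short Sign.+ Sign.-) = from-yes (shift? α)
    shift≢0 α@(short Sign.- Sign.+) = from-yes (shift? α)
    shift≢0 α@(short Sign.- Sign.-) = from-yes (shift? α)
    shift≢0 α@(long 0F Sign.+) = from-yes (shift? α)
    shift≢0 α@(long 0F Sign.-) = from-yes (shift? α)
    shift≢0 α@(long 1F Sign.+) = from-yes (shift? α)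
    shift≢0 α@(long 1F Sign.-) = from-yes (shift? α)

  e-square-zero : ∀ α i k j → e α i k ≡ 0ℤ ⊎ e α k j ≡ 0ℤ
  e-square-zero α i k j with shift≢0 α i k j
  ... | inj₁ s≢0 = inj₁ (e-zero α i k s≢0)
  ... | inj₂ s≢0 = inj₂ (e-zero α k j s≢0)

------------------------------------------------------------------------
-- Chevalley groups of type C₂

module Chevalley (𝓑 : ChevalleyBasis) (R : CommutativeRing c ℓ) where

  open ChevalleyBasis 𝓑 using (e)
  open CommutativeRing R
  open RawMonoidDefs +-rawMonoid using () renaming (_×_ to _⨯_)
  open SumProperties semiring using (sum-syntax; sum-cong-≋; ∑-distrib-+)
  private module M = Matrices R
  open M using (Matrix; Invertible; GL)
  open import Relation.Binary.Reasoning.Setoid setoid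

  fromℤ : ℤ → Carrier
  fromℤ (+ n)    = n ⨯ 1#
  fromℤ -[1+ n ] = - (ℕ.suc n ⨯ 1#)

  -- exp (t e_α): the series stops at the linear term because e_α² = 0 on
  -- the natural module, see e-square-zero.
  exp-te : Root → Carrier → Matrix 4
  exp-te α t i j = M.1ᴹ i j + t * fromℤ (e α i j)

  private
    term : ∀ α i k j t s → exp-te α t i k * exp-te α s k j ≈
           (M.1ᴹ i k * M.1ᴹ k j + M.1ᴹ i k * (s * fromℤ (e α k j))) + (t * fromℤ (e α i k)) * M.1ᴹ k j
    term α i k j t s = begin
      (d + x) * (d′ + y)               ≈⟨ distribʳ (d′ + y) d x ⟩
      d * (d′ + y) + x * (d′ + y)      ≈⟨ +-cong (distribˡ d d′ y) (distribˡ x d′ y) ⟩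
      d * d′ + d * y + (x * d′ + x * y)  ≈⟨ +-congˡ (trans (+-congˡ xy≈0) (+-identityʳ _)) ⟩
      d * d′ + d * y + x * d′          ∎
      where
      d  = M.1ᴹ i k
      d′ = M.1ᴹ k j
      x  = t * fromℤ (e α i k)
      y  = s * fromℤ (e α k j)
      xy≈0 : x * y ≈ 0#
      xy≈0 with e-square-zero 𝓑 α i k j
      ... | inj₁ z = trans (*-congʳ (trans (*-congˡ (reflexive (≡.cong fromℤ z))) (zeroʳ t))) (zeroˡ y)
      ... | inj₂ z = trans (*-congˡ (trans (*-congˡ (reflexive (≡.cong fromℤ z))) (zeroʳ s))) (zeroʳ x)

    exp-inverse : ∀ α t s → s + t ≈ 0# → exp-te α t M.*ᴹ exp-te α s M.≋ M.1ᴹ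
    exp-inverse α t s s+t≈0 i j = begin
      ∑[ k < 4 ] (exp-te α t i k * exp-te α s k j)  ≈⟨ sum-cong-≋ (λ k → term α i k j t s) ⟩
      ∑[ k < 4 ] (f k + g k + h k)                  ≈⟨ ∑-distrib-+ (λ k → f k + g k) h ⟩
      ∑[ k < 4 ] (f k + g k) + ∑[ k < 4 ] h k       ≈⟨ +-congʳ (∑-distrib-+ f g) ⟩
      ∑[ k < 4 ] f k + ∑[ k < 4 ] g k + ∑[ k < 4 ] h k
        ≈⟨ +-cong (+-cong (M.∑-1ᴹˡ i (λ k → M.1ᴹ k j)) (M.∑-1ᴹˡ i (λ k → s * fromℤ (e α k j))))
                  (M.∑-1ᴹʳ j (λ k → t * fromℤ (e α i k))) ⟩
      M.1ᴹ i j + s * x + t * x                      ≈⟨ +-assoc _ _ _ ⟩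
      M.1ᴹ i j + (s * x + t * x)                    ≈⟨ +-congˡ (distribʳ x s t) ⟨
      M.1ᴹ i j + (s + t) * x                        ≈⟨ +-congˡ (trans (*-congʳ s+t≈0) (zeroˡ x)) ⟩
      M.1ᴹ i j + 0#                                 ≈⟨ +-identityʳ _ ⟩
      M.1ᴹ i j                                      ∎
      where
      x = fromℤ (e α i j)
      f g h : Fin 4 → Carrier
      f k = M.1ᴹ i k * M.1ᴹ k j
      g k = M.1ᴹ i k * (s * fromℤ (e α k j))
      h k = (t * fromℤ (e α i k)) * M.1ᴹ k j

  x : Root → Carrier → Invertible 4
  x α t = record
    { mat     = exp-te α t
    ; inv     = exp-te α (- t)
    ; mat*inv = exp-inverse α t (- t) (-‿inverseˡ t)
    ; inv*mat = exp-inverse α (- t) t (-‿inverseʳ t)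
    }

  E : Pred (Invertible 4) (c ⊔ ℓ)
  E = Generated (GL 4) λ g → ∃[ α ] ∃[ t ] Group._≈_ (GL 4) g (x α t)

  evalAt : Expr ℤ (4 ℕ.* 4) → Matrix 4 → Carrier
  evalAt f A = Eval.⟦_⟧ rawRing fromℤ f (tabulate λ k → uncurry A (remQuot 4 k))

-- The scheme is cut out by all polynomials in ℤ[x₁₁,…,x₄₄] that vanish on the
-- complex group, the group generated by all x_α(t) with t ∈ ℂ.  These are the
-- polynomials vanishing on the elementary group over ℚ: for fixed α₁,…,αₘ the
-- value at x_α₁(t₁)⋯x_αₘ(tₘ) is an integer polynomial in t₁,…,tₘ, which
-- vanishes on ℂᵐ iff it vanishes on ℚᵐ.
DefiningEquation : ChevalleyBasis → Pred (Expr ℤ (4 ℕ.* 4)) 0ℓ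
DefiningEquation 𝓑 f = ∀ g → E g → evalAt f (mat g) ≡ 0ℚ
  where
  open Chevalley 𝓑 ℚ.+-*-commutativeRing
  open Matrices ℚ.+-*-commutativeRing using (mat)

module _ (𝓑 : ChevalleyBasis) (R : CommutativeRing c ℓ) where

  open CommutativeRing R using (_≈_; 0#)
  open Matrices R using (Invertible; mat; GL)
  open Chevalley 𝓑 R

  G-sc : Pred (Invertible 4) ℓ
  G-sc g = ∀ f → DefiningEquation 𝓑 f → evalAt f (mat g) ≈ 0#

  record LargeSubgroup (p : Level) : Set (c ⊔ ℓ ⊔ suc p) where
    field
      subgroup : Subgroup (GL 4) p

    open Subgroup subgroup public

    field
      inside : member ⊆ G-sc
      large  : E ⊆ member

  Y : Pred (Invertible 4) (c ⊔ ℓ)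
  Y g = ∃[ t ] g ≈ᴳ x e₁+e₂ t ∙ x 2e₂ t
    where open Group (GL 4) using (_∙_) renaming (_≈_ to _≈ᴳ_)

Has½ : CommutativeRing c ℓ → Set (c ⊔ ℓ)
Has½ R = ∃[ u ] (1# + 1#) * u ≈ 1#
  where open CommutativeRing R

module Submission where

-- Let C be the centraliser in G of x_{2e₂}(1), x_{-2e₂}(1) and x_{e₁+e₂}(1).
-- Comparing matrix entries, every element of C is a x_{2e₁}(τ) for a scalar
-- a ∈ R*, and C contains all x_{2e₁}(τ).  Scalars do not affect commutators, and
-- [x_{2e₁}(τ) , x_{e₂-e₁}(s)] = x_{e₁+e₂}(-sτ) x_{2e₂}(-s²τ) in the standard
-- Chevalley basis.  Any other Chevalley basis differs from the standard one only
-- in signs, so for s = ±1 chosen suitably Y = { [y , x_{e₂-e₁}(s)] | y ∈ C }.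

open import Defs
open import Algebra.Bundles using (CommutativeRing; Group)
import Algebra.Properties.Group as GroupProperties
import Algebra.Properties.Ring as RingProperties
import Algebra.Properties.Semiring.Sum as SumProperties
import Algebra.Solver.Ring.NaturalCoefficients.Default as SemiringSolver
open import Data.Bool.Base using (if_then_else_; true; false)
open import Data.Fin.Base using (Fin; opposite)
open import Data.Fin.Patterns using (0F; 1F; 2F; 3F)
open import Data.Fin.Properties using (_≟_; all?; any?)
open import Data.Integer.Base as ℤ using (ℤ; +_; -[1+_]; 0ℤ; 1ℤ; -1ℤ; _◃_)
import Data.Integer.Properties as ℤ
open import Data.Integer.Tactic.RingSolver using (solve-∀)
open import Data.Maybe.Base using (Maybe; just; nothing)
open import Data.Nat.Base as ℕ using (ℕ)
import Data.Nat.Properties as ℕ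
open import Data.Product.Base using (Σ; ∃-syntax; _×_; _,_; proj₁; proj₂)
open import Data.Sign.Base as Sign using (Sign)
open import Data.Sum.Base using (_⊎_; inj₁; inj₂)
open import Data.Vec.Functional using (Vector; _∷_)
open import Function.Bundles using (mk⇔)
open import Relation.Binary.PropositionalEquality as ≡ using (_≡_; _≢_)
open import Relation.Nullary.Decidable using (True; toWitness; does; from-yes; ¬?; _×-dec_; _⊎-dec_)
open import Relation.Nullary.Negation using (¬_; contradiction)

2e₁ e₂-e₁ : Root
2e₁   = long 0F Sign.+
e₂-e₁ = short Sign.- Sign.+

e° : Root → ℤᴹ.Matrix 4
e° = ChevalleyBasis.e standardBasis

-- Root vectors of an arbitrary Chevalley basis of 𝔰𝔭₄, compared with the standard ones.

module _ where

  open ≡ using (refl; sym; trans; cong; cong₂)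
  open CommutativeRing ℤ.+-*-commutativeRing using (semiring)
  open SumProperties semiring using (sum-syntax; sum-cong-≋; *-distribˡ-sum)
  open ℤᴹ using (_≋_; _+ᴹ_; _*ᴹ_; _·ᴹ_; _ᵀ; 0ᴹ; 1ᴹ; ⁅_,_⁆; ∑-zero; ∑-1ᴹˡ; ∑-1ᴹʳ)
  open ≡.≡-Reasoning

  -- How far E_ij is from having weight α with respect to the coroot h.
  defect : ℤ × ℤ → Root → Fin 4 → Fin 4 → ℤ
  defect h α i j = ⟨ weight i , h ⟩ ℤ.- ⟨ weight j , h ⟩ ℤ.- ⟨ vec α , h ⟩

  -- This is the `root-vector` axiom read entrywise: bracketing with the diagonal matrix `cartan h`
  -- scales the entry at (i , j) by ⟨ weight i , h ⟩ - ⟨ weight j , h ⟩.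
  defect*e : ∀ (𝓑 : ChevalleyBasis) β α i j → defect (coroot β) α i j ℤ.* ChevalleyBasis.e 𝓑 α i j ≡ 0ℤ
  defect*e 𝓑 β α i j = begin
    (u ℤ.- v ℤ.- m) ℤ.* y                        ≡⟨ expand u v m y ⟩
    (u ℤ.* y ℤ.- y ℤ.* v) ℤ.- m ℤ.* y            ≡⟨ cong₂ (λ a b → a ℤ.- b ℤ.- m ℤ.* y) left right ⟨
    ⁅ cartan h , e α ⁆ i j ℤ.- m ℤ.* y           ≡⟨ cong (ℤ._- m ℤ.* y) (root-vector α β i j) ⟩
    m ℤ.* y ℤ.- m ℤ.* y                          ≡⟨ ℤ.+-inverseʳ (m ℤ.* y) ⟩
    0ℤ                                           ∎
    where
    open ChevalleyBasis 𝓑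
    h = coroot β
    u = ⟨ weight i , h ⟩
    v = ⟨ weight j , h ⟩
    m = ⟨ vec α , h ⟩
    y = e α i j
    expand : ∀ u v m y → (u ℤ.- v ℤ.- m) ℤ.* y ≡ (u ℤ.* y ℤ.- y ℤ.* v) ℤ.- m ℤ.* y
    expand = solve-∀
    left : (cartan h *ᴹ e α) i j ≡ u ℤ.* y
    left = begin
      (cartan h *ᴹ e α) i j                   ≡⟨ sum-cong-≋ (λ k → ℤ.*-assoc u (1ᴹ i k) (e α k j)) ⟩
      ∑[ k < 4 ] (u ℤ.* (1ᴹ i k ℤ.* e α k j))  ≡⟨ *-distribˡ-sum u (λ k → 1ᴹ i k ℤ.* e α k j) ⟨
      u ℤ.* ∑[ k < 4 ] (1ᴹ i k ℤ.* e α k j)    ≡⟨ cong (u ℤ.*_) (∑-1ᴹˡ i (λ k → e α k j)) ⟩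
      u ℤ.* y                                 ∎
    right : (e α *ᴹ cartan h) i j ≡ y ℤ.* v
    right = trans
      (sum-cong-≋ λ k → sym (ℤ.*-assoc (e α i k) ⟨ weight k , h ⟩ (1ᴹ k j)))
      (∑-1ᴹʳ j (λ k → e α i k ℤ.* ⟨ weight k , h ⟩))

  e-zero : ∀ (𝓑 : ChevalleyBasis) β α i j → defect (coroot β) α i j ≢ 0ℤ → ChevalleyBasis.e 𝓑 α i j ≡ 0ℤ
  e-zero 𝓑 β α i j d≢0 with ℤ.i*j≡0⇒i≡0∨j≡0 (defect (coroot β) α i j) (defect*e 𝓑 β α i j)
  ... | inj₁ d≡0 = contradiction d≡0 d≢0
  ... | inj₂ y≡0 = y≡0

  -- A matrix position (i , j) with weight i - weight j = α; the only other such
  -- position is its reflection (opposite j , opposite i) in the antidiagonal.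
  row col : Root → Fin 4
  row (short Sign.+ _)      = 0F
  row (short Sign.- Sign.+) = 1F
  row (short Sign.- Sign.-) = 2F
  row (long 0F Sign.+)       = 0F
  row (long 0F Sign.-)       = 3F
  row (long 1F Sign.+)       = 1F
  row (long 1F Sign.-)       = 2F
  col (short Sign.+ Sign.+) = 2F
  col (short Sign.+ Sign.-) = 1F
  col (short Sign.- _)      = 0F
  col (long 0F Sign.+)       = 3F
  col (long 0F Sign.-)       = 0F
  col (long 1F Sign.+)       = 2F
  col (long 1F Sign.-)       = 1F

  -- The coroots of 2e₁ and 2e₂ are e₁ and e₂, so a position where both defects vanish has weight
  -- difference exactly α. What remains is a finite check.
  position : ∀ α i j →
    (i ≡ row α × j ≡ col α) ⊎ (i ≡ opposite (col α) × j ≡ opposite (row α)) ⊎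
    (∃[ k ] defect (coroot (long k Sign.+)) α i j ≢ 0ℤ)
  position = from-yes (allRoots? λ α → all? λ i → all? λ j →
    (i ≟ row α ×-dec j ≟ col α) ⊎-dec (i ≟ opposite (col α) ×-dec j ≟ opposite (row α)) ⊎-dec
    any? λ k → ¬? (defect (coroot (long k Sign.+)) α i j ℤ.≟ 0ℤ))

  e°-row : ∀ α k → e° α (row α) k ≡ 1ᴹ (col α) k
  e°-row = from-yes (allRoots? λ α → all? λ k → e° α (row α) k ℤ.≟ 1ᴹ (col α) k)

  e°-row-⊝ : ∀ α k → e° (⊝ α) (row α) k ≡ 0ℤ
  e°-row-⊝ = from-yes (allRoots? λ α → all? λ k → e° (⊝ α) (row α) k ℤ.≟ 0ℤ)

  e°-position : ∀ α → e° α (row α) (col α) ≡ 1ℤ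
  e°-position = from-yes (allRoots? λ α → e° α (row α) (col α) ℤ.≟ 1ℤ)

  J-sign : Fin 4 → ℤ
  J-sign i = J i (opposite i)

  J-row : ∀ i k → J i k ≡ J-sign i ℤ.* 1ᴹ (opposite i) k
  J-row = from-yes (all? λ i → all? λ k → J i k ℤ.≟ J-sign i ℤ.* 1ᴹ (opposite i) k)

  J-col : ∀ i k → J k (opposite i) ≡ 1ᴹ k i ℤ.* J-sign i
  J-col = from-yes (all? λ i → all? λ k → J k (opposite i) ℤ.≟ 1ᴹ k i ℤ.* J-sign i)

  J-sign² : ∀ i → J-sign i ℤ.* J-sign i ≡ 1ℤ
  J-sign² = from-yes (all? λ i → J-sign i ℤ.* J-sign i ℤ.≟ 1ℤ)

  -- Each row and column of `J` has a single nonzero entry, equal to ±1, so the entry at (j ,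
  -- opposite i) of the isometry equation has just two terms.
  𝔰𝔭-reflection : ∀ X → X ᵀ *ᴹ J +ᴹ J *ᴹ X ≋ 0ᴹ → ∀ i j →
    X (opposite j) (opposite i) ≡ ℤ.- (J-sign j ℤ.* (J-sign i ℤ.* X i j))
  𝔰𝔭-reflection X X∈𝔰𝔭 i j = begin
    z                                     ≡⟨ ℤ.*-identityˡ z ⟨
    1ℤ ℤ.* z                              ≡⟨ cong (ℤ._* z) (J-sign² j) ⟨
    (σ ℤ.* σ) ℤ.* z                       ≡⟨ rearrange σ τ y z ⟩
    σ ℤ.* (y ℤ.* τ ℤ.+ σ ℤ.* z) ℤ.- σ ℤ.* (τ ℤ.* y)
      ≡⟨ cong (λ w → σ ℤ.* w ℤ.- σ ℤ.* (τ ℤ.* y)) (trans (sym (cong₂ ℤ._+_ left right)) (X∈𝔰𝔭 j (opposite i))) ⟩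
    σ ℤ.* 0ℤ ℤ.- σ ℤ.* (τ ℤ.* y)          ≡⟨ cong (ℤ._- σ ℤ.* (τ ℤ.* y)) (ℤ.*-zeroʳ σ) ⟩
    0ℤ ℤ.- σ ℤ.* (τ ℤ.* y)                ≡⟨ ℤ.+-identityˡ _ ⟩
    ℤ.- (σ ℤ.* (τ ℤ.* y))                 ∎
    where
    σ = J-sign j
    τ = J-sign i
    y = X i j
    z = X (opposite j) (opposite i)
    rearrange : ∀ σ τ y z → (σ ℤ.* σ) ℤ.* z ≡ σ ℤ.* (y ℤ.* τ ℤ.+ σ ℤ.* z) ℤ.- σ ℤ.* (τ ℤ.* y)
    rearrange = solve-∀
    swap : ∀ a b c → a ℤ.* (b ℤ.* c) ≡ a ℤ.* c ℤ.* b
    swap = solve-∀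
    left : (X ᵀ *ᴹ J) j (opposite i) ≡ y ℤ.* τ
    left = trans
      (sum-cong-≋ λ k → trans (cong (X k j ℤ.*_) (J-col i k)) (swap (X k j) (1ᴹ k i) τ))
      (∑-1ᴹʳ i (λ k → X k j ℤ.* τ))
    right : (J *ᴹ X) j (opposite i) ≡ σ ℤ.* z
    right = begin
      (J *ᴹ X) j (opposite i)
        ≡⟨ sum-cong-≋ (λ k → trans (cong (ℤ._* X k (opposite i)) (J-row j k)) (ℤ.*-assoc σ (1ᴹ (opposite j) k) (X k (opposite i)))) ⟩
      ∑[ k < 4 ] (σ ℤ.* (1ᴹ (opposite j) k ℤ.* X k (opposite i)))
        ≡⟨ *-distribˡ-sum σ (λ k → 1ᴹ (opposite j) k ℤ.* X k (opposite i)) ⟨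
      σ ℤ.* ∑[ k < 4 ] (1ᴹ (opposite j) k ℤ.* X k (opposite i))
        ≡⟨ cong (σ ℤ.*_) (∑-1ᴹˡ (opposite j) (λ k → X k (opposite i))) ⟩
      σ ℤ.* z ∎

  unit-sign : ∀ m n → m ℤ.* n ≡ 1ℤ → ∃[ s ] m ≡ s ◃ 1
  unit-sign m n mn≡1 = ℤ.sign m , (begin
    m                      ≡⟨ ℤ.signᵢ◃∣i∣≡i m ⟨
    ℤ.sign m ◃ ℤ.∣ m ∣     ≡⟨ cong (ℤ.sign m ◃_) (ℕ.m*n≡1⇒m≡1 ℤ.∣ m ∣ ℤ.∣ n ∣ (trans (sym (ℤ.∣i*j∣≡∣i∣*∣j∣ m n)) (cong ℤ.∣_∣ mn≡1))) ⟩
    ℤ.sign m ◃ 1           ∎)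

  module _ (𝓑 : ChevalleyBasis) where

    open ChevalleyBasis 𝓑

    -- The root space of α in 𝔰𝔭₄ is one-dimensional: the entry at the chosen position determines
    -- the reflected one through the form, by the same rule for `e α` and `e° α`, and every other
    -- entry has the wrong weight and vanishes in both.
    e-proportional : ∀ α → e α ≋ e α (row α) (col α) ·ᴹ e° α
    e-proportional α i j with position α i j
    ... | inj₁ (refl , refl) = sym (trans (cong (ε ℤ.*_) (e°-position α)) (ℤ.*-identityʳ ε))
      where ε = e α (row α) (col α)
    ... | inj₂ (inj₁ (refl , refl)) = begin
      e α (opposite c) (opposite r)            ≡⟨ 𝔰𝔭-reflection (e α) (e∈𝔰𝔭 α) r c ⟩
      ℤ.- (σ ℤ.* (τ ℤ.* ε))                    ≡⟨ factor σ τ ε ⟩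
      ε ℤ.* ℤ.- (σ ℤ.* (τ ℤ.* 1ℤ))             ≡⟨ cong (λ w → ε ℤ.* ℤ.- (σ ℤ.* (τ ℤ.* w))) (e°-position α) ⟨
      ε ℤ.* ℤ.- (σ ℤ.* (τ ℤ.* e° α r c))
        ≡⟨ cong (ε ℤ.*_) (𝔰𝔭-reflection (e° α) (ChevalleyBasis.e∈𝔰𝔭 standardBasis α) r c) ⟨
      ε ℤ.* e° α (opposite c) (opposite r)     ∎
      where
      r = row α
      c = col α
      σ = J-sign c
      τ = J-sign r
      ε = e α r c
      factor : ∀ σ τ ε → ℤ.- (σ ℤ.* (τ ℤ.* ε)) ≡ ε ℤ.* ℤ.- (σ ℤ.* (τ ℤ.* 1ℤ))
      factor = solve-∀
    ... | inj₂ (inj₂ (k , d≢0)) = begin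
      e α i j             ≡⟨ e-zero 𝓑 (long k Sign.+) α i j d≢0 ⟩
      0ℤ                  ≡⟨ ℤ.*-zeroʳ ε ⟨
      ε ℤ.* 0ℤ            ≡⟨ cong (ε ℤ.*_) (e-zero standardBasis (long k Sign.+) α i j d≢0) ⟨
      ε ℤ.* e° α i j      ∎
      where ε = e α (row α) (col α)

    -- Compare diagonal entries at `row α` in the `coroots` axiom: this row of `e α` is supported at
    -- `col α`, the same row of `e (⊝ α)` vanishes, and the coroot pairs to 1 with the weight. The
    -- two coefficients are thus mutually inverse integers.
    e-unit : ∀ α → e α (row α) (col α) ℤ.* e (⊝ α) (col α) (row α) ≡ 1ℤ
    e-unit α = begin
      ε ℤ.* e (⊝ α) c r                   ≡⟨ ℤ.+-identityʳ _ ⟨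
      ε ℤ.* e (⊝ α) c r ℤ.- 0ℤ            ≡⟨ cong₂ ℤ._-_ left right ⟨
      ⁅ e α , e (⊝ α) ⁆ r r               ≡⟨ coroots α r r ⟩
      cartan (coroot α) r r               ≡⟨ from-yes (allRoots? λ α → cartan (coroot α) (row α) (row α) ℤ.≟ 1ℤ) α ⟩
      1ℤ                                  ∎
      where
      r = row α
      c = col α
      ε = e α r c
      swap : ∀ a b c → a ℤ.* b ℤ.* c ≡ b ℤ.* (a ℤ.* c)
      swap = solve-∀
      left : (e α *ᴹ e (⊝ α)) r r ≡ ε ℤ.* e (⊝ α) c r
      left = trans
        (sum-cong-≋ λ k → trans
          (cong (ℤ._* e (⊝ α) k r) (trans (e-proportional α r k) (cong (ε ℤ.*_) (e°-row α k))))
          (swap ε (1ᴹ c k) (e (⊝ α) k r)))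
        (∑-1ᴹˡ c (λ k → ε ℤ.* e (⊝ α) k r))
      right : (e (⊝ α) *ᴹ e α) r r ≡ 0ℤ
      right = ∑-zero (λ k → e (⊝ α) r k ℤ.* e α k r) λ k →
        cong (ℤ._* e α k r) (trans (e-proportional (⊝ α) r k)
          (trans (cong (ε⁻ ℤ.*_) (e°-row-⊝ α k)) (ℤ.*-zeroʳ ε⁻)))
        where ε⁻ = e (⊝ α) (row (⊝ α)) (col (⊝ α))

    -- The proportionality factor is a unit of ℤ. This reduces every Chevalley basis to the standard
    -- one up to signs of the parameters.
    e-sign : ∀ α → ∃[ s ] e α ≋ (s ◃ 1) ·ᴹ e° α
    e-sign α = proj₁ unit , λ i j →
      trans (e-proportional α i j) (cong (ℤ._* e° α i j) (proj₂ unit))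
      where unit = unit-sign (e α (row α) (col α)) (e (⊝ α) (col α) (row α)) (e-unit α)

-- Matrices over R in the standard Chevalley basis.

module _ {c ℓ} (R : CommutativeRing c ℓ) where

  open CommutativeRing R
  open RingProperties ring using (-0#≈0#; -‿involutive; -1*x≈-x; +-cancelˡ)
  open SumProperties semiring using (sum-syntax; sum-cong-≋; *-distribˡ-sum; ∑-distrib-+)
  open Matrices R
  open import Relation.Binary.Reasoning.Setoid setoid
  private
    module ° = Chevalley standardBasis R
    module 𝔾 = Group (GL 4)
  open ° using (fromℤ; exp-te)
  module Solver = SemiringSolver commutativeSemiring

  sgn : Sign → Carrier
  sgn Sign.+ = 1#
  sgn Sign.- = - 1#

  sgn² : ∀ s → sgn s * sgn s ≈ 1#
  sgn² Sign.+ = *-identityˡ 1#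
  sgn² Sign.- = trans (-1*x≈-x (- 1#)) (-‿involutive 1#)

  fromℤ-neg : ∀ z → fromℤ (ℤ.- z) ≈ - fromℤ z
  fromℤ-neg (+ ℕ.zero)  = sym -0#≈0#
  fromℤ-neg (+ ℕ.suc n) = refl
  fromℤ-neg -[1+ n ]    = sym (-‿involutive _)

  fromℤ-sign : ∀ s z → fromℤ ((s ◃ 1) ℤ.* z) ≈ sgn s * fromℤ z
  fromℤ-sign Sign.+ z = trans (reflexive (≡.cong fromℤ (ℤ.*-identityˡ z))) (sym (*-identityˡ _))
  fromℤ-sign Sign.- z = begin
    fromℤ (-1ℤ ℤ.* z)    ≡⟨ ≡.cong fromℤ (ℤ.-1*i≡-i z) ⟩
    fromℤ (ℤ.- z)        ≈⟨ fromℤ-neg z ⟩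
    - fromℤ z            ≈⟨ -1*x≈-x (fromℤ z) ⟨
    - 1# * fromℤ z       ∎

  N : Root → Matrix 4
  N α i j = fromℤ (e° α i j)

  -- The semiring solver knows no negation, so -1 is an indeterminate m for it and
  -- the relation 1 + m ≈ 0 is applied afterwards.
  m : Carrier
  m = fromℤ -1ℤ

  -- The commutator of a long and a short root element.

  module _ where
    open Solver using (Polynomial; con; _:+_; _:*_; _:=_)

    PolyMatrix : ℕ → Set
    PolyMatrix n = Fin 4 → Fin 4 → Polynomial n

    infixl 7 _⊛_
    -- The trailing `con 0` copies the unfolding of a sum over `Fin 4`, so that evaluation yields
    -- the entries of `_*ᴹ_` definitionally.
    _⊛_ : ∀ {n} → PolyMatrix n → PolyMatrix n → PolyMatrix n
    (A ⊛ B) i j = A i 0F :* B 0F j :+ (A i 1F :* B 1F j :+ (A i 2F :* B 2F j :+ (A i 3F :* B 3F j :+ con 0)))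

    -- Mirrors the unfolding of `fromℤ`. Every negative constructor goes to `m` because -1 is the
    -- only negative entry of the matrices `e° α`.
    integer : ∀ {n} → Polynomial n → ℤ → Polynomial n
    integer m (+ ℕ.zero)  = con 0
    integer m (+ ℕ.suc n) = con 1 :+ integer m (+ n)
    integer m -[1+ _ ]    = m

    exp : ∀ {n} → Polynomial n → Root → Polynomial n → PolyMatrix n
    exp m α t i j = (if does (i ≟ j) then con 1 else con 0) :+ t :* integer m (e° α i j)

    -- The cofactor of 1 + m in the difference of the two sides, while m is still an indeterminate.
    discrepancyᴾ : ∀ {n} → Polynomial n → Polynomial n → Polynomial n → Polynomial n → PolyMatrix n
    discrepancyᴾ m a s τ 1F 3F = s :* τ :* a
    discrepancyᴾ m a s τ 1F 2F = m :* s :* s :* τ :* a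
    discrepancyᴾ m a s τ _  _  = con 0

    lhs rhs : ∀ i j (m a s τ : Polynomial 4) → Polynomial 4
    lhs i j m a s τ = ((exp m e₁+e₂ (m :* s :* τ) ⊛ exp m 2e₂ (s :* (m :* s :* τ))) ⊛
      (exp m e₂-e₁ s ⊛ λ i j → a :* exp m 2e₁ τ i j)) i j
    rhs i j m a s τ = ((λ i j → a :* exp m 2e₁ τ i j) ⊛ exp m e₂-e₁ s) i j
      :+ (con 1 :+ m) :* discrepancyᴾ m a s τ i j

    equation : ∀ i j (m a s τ : Polynomial 4) → _
    equation i j m a s τ = lhs i j m a s τ := rhs i j m a s τ

  discrepancy : Carrier → Carrier → Carrier → Matrix 4
  discrepancy a s τ 1F 3F = s * τ * a
  discrepancy a s τ 1F 2F = m * s * s * τ * a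
  discrepancy a s τ _  _  = 0#

  -- The identity is solved one entry at a time, since the reified entries reduce to polynomials
  -- only at concrete indices.
  conjugation-entry : ∀ a s τ i j →
    (exp-te e₁+e₂ (m * s * τ) *ᴹ exp-te 2e₂ (s * (m * s * τ)) *ᴹ
    (exp-te e₂-e₁ s *ᴹ (a ·ᴹ exp-te 2e₁ τ))) i j ≈
    ((a ·ᴹ exp-te 2e₁ τ) *ᴹ exp-te e₂-e₁ s) i j + (1# + m) * discrepancy a s τ i j
  conjugation-entry a s τ 0F 0F = Solver.solve 4 (equation 0F 0F) refl m a s τ
  conjugation-entry a s τ 0F 1F = Solver.solve 4 (equation 0F 1F) refl m a s τ
  conjugation-entry a s τ 0F 2F = Solver.solve 4 (equation 0F 2F) refl m a s τ
  conjugation-entry a s τ 0F 3F = Solver.solve 4 (equation 0F 3F) refl m a s τ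
  conjugation-entry a s τ 1F 0F = Solver.solve 4 (equation 1F 0F) refl m a s τ
  conjugation-entry a s τ 1F 1F = Solver.solve 4 (equation 1F 1F) refl m a s τ
  conjugation-entry a s τ 1F 2F = Solver.solve 4 (equation 1F 2F) refl m a s τ
  conjugation-entry a s τ 1F 3F = Solver.solve 4 (equation 1F 3F) refl m a s τ
  conjugation-entry a s τ 2F 0F = Solver.solve 4 (equation 2F 0F) refl m a s τ
  conjugation-entry a s τ 2F 1F = Solver.solve 4 (equation 2F 1F) refl m a s τ
  conjugation-entry a s τ 2F 2F = Solver.solve 4 (equation 2F 2F) refl m a s τ
  conjugation-entry a s τ 2F 3F = Solver.solve 4 (equation 2F 3F) refl m a s τ
  conjugation-entry a s τ 3F 0F = Solver.solve 4 (equation 3F 0F) refl m a s τ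
  conjugation-entry a s τ 3F 1F = Solver.solve 4 (equation 3F 1F) refl m a s τ
  conjugation-entry a s τ 3F 2F = Solver.solve 4 (equation 3F 2F) refl m a s τ
  conjugation-entry a s τ 3F 3F = Solver.solve 4 (equation 3F 3F) refl m a s τ

  1+m≈0 : 1# + m ≈ 0#
  1+m≈0 = trans (+-congˡ (-‿cong (+-identityʳ 1#))) (-‿inverseʳ 1#)

  m² : m * m ≈ 1#
  m² = trans (*-cong m≈-1 m≈-1) (sgn² Sign.-)
    where
    m≈-1 : m ≈ - 1#
    m≈-1 = -‿cong (+-identityʳ 1#)

  -- The Chevalley commutator formula in the inverse-free form h c y = y c, with y = a x_{2e₁}(τ)
  -- and c = x_{e₂-e₁}(s). The scalar a cancels from h.
  conjugation : ∀ a s τ →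
    exp-te e₁+e₂ (m * s * τ) *ᴹ exp-te 2e₂ (s * (m * s * τ)) *ᴹ
    (exp-te e₂-e₁ s *ᴹ (a ·ᴹ exp-te 2e₁ τ)) ≋
    (a ·ᴹ exp-te 2e₁ τ) *ᴹ exp-te e₂-e₁ s
  conjugation a s τ i j = trans (conjugation-entry a s τ i j)
    (trans (+-congˡ (trans (*-congʳ 1+m≈0) (zeroˡ _))) (+-identityʳ _))

  -- Commuting with root elements.

  *ᴹ-exp : ∀ A α t i j → (A *ᴹ exp-te α t) i j ≈ A i j + t * (A *ᴹ N α) i j
  *ᴹ-exp A α t i j = begin
    ∑[ k < 4 ] (A i k * (1ᴹ k j + t * N α k j))
      ≈⟨ sum-cong-≋ (λ k → trans (distribˡ (A i k) (1ᴹ k j) (t * N α k j)) (+-congˡ (swap (A i k) t (N α k j)))) ⟩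
    ∑[ k < 4 ] (A i k * 1ᴹ k j + t * (A i k * N α k j))
      ≈⟨ ∑-distrib-+ (λ k → A i k * 1ᴹ k j) (λ k → t * (A i k * N α k j)) ⟩
    ∑[ k < 4 ] (A i k * 1ᴹ k j) + ∑[ k < 4 ] (t * (A i k * N α k j))
      ≈⟨ +-cong (∑-1ᴹʳ j (A i)) (sym (*-distribˡ-sum t (λ k → A i k * N α k j))) ⟩
    A i j + t * (A *ᴹ N α) i j ∎
    where
    swap : ∀ a b c → a * (b * c) ≈ b * (a * c)
    swap = Solver.solve 3 (λ a b c → a Solver.:* (b Solver.:* c) Solver.:= b Solver.:* (a Solver.:* c)) refl

  exp-*ᴹ : ∀ A α t i j → (exp-te α t *ᴹ A) i j ≈ A i j + t * (N α *ᴹ A) i j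
  exp-*ᴹ A α t i j = begin
    ∑[ k < 4 ] ((1ᴹ i k + t * N α i k) * A k j)
      ≈⟨ sum-cong-≋ (λ k → trans (distribʳ (A k j) (1ᴹ i k) (t * N α i k)) (+-congˡ (*-assoc t (N α i k) (A k j)))) ⟩
    ∑[ k < 4 ] (1ᴹ i k * A k j + t * (N α i k * A k j))
      ≈⟨ ∑-distrib-+ (λ k → 1ᴹ i k * A k j) (λ k → t * (N α i k * A k j)) ⟩
    ∑[ k < 4 ] (1ᴹ i k * A k j) + ∑[ k < 4 ] (t * (N α i k * A k j))
      ≈⟨ +-cong (∑-1ᴹˡ i (λ k → A k j)) (sym (*-distribˡ-sum t (λ k → N α i k * A k j))) ⟩
    A i j + t * (N α *ᴹ A) i j ∎

  -- Subtracting A from both sides leaves t A N = t N A, and t is its own inverse. It is applied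
  -- with t the sign of a root vector.
  commutes-N : ∀ A α {t} → t * t ≈ 1# → A *ᴹ exp-te α t ≋ exp-te α t *ᴹ A → A *ᴹ N α ≋ N α *ᴹ A
  commutes-N A α {t} t² comm i j = begin
    (A *ᴹ N α) i j             ≈⟨ cancel _ ⟨
    t * (t * (A *ᴹ N α) i j)   ≈⟨ *-congˡ (+-cancelˡ (A i j) _ _ (trans (sym (*ᴹ-exp A α t i j)) (trans (comm i j) (exp-*ᴹ A α t i j)))) ⟩
    t * (t * (N α *ᴹ A) i j)   ≈⟨ cancel _ ⟩
    (N α *ᴹ A) i j             ∎
    where
    cancel : ∀ z → t * (t * z) ≈ z
    cancel z = trans (sym (*-assoc t t z)) (trans (*-congʳ t²) (*-identityˡ z))

  -- The hypothesis makes both products of `N α` and `N β` vanish term by term, so either order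
  -- gives 1 + t N α + u N β.
  exp-commute : ∀ α β →
    (∀ i k j → (e° α i k ≡ 0ℤ ⊎ e° β k j ≡ 0ℤ) × (e° β i k ≡ 0ℤ ⊎ e° α k j ≡ 0ℤ)) →
    ∀ t u → exp-te α t *ᴹ exp-te β u ≋ exp-te β u *ᴹ exp-te α t
  exp-commute α β zeros t u i j = begin
    (exp-te α t *ᴹ exp-te β u) i j                        ≈⟨ *ᴹ-exp (exp-te α t) β u i j ⟩
    exp-te α t i j + u * (exp-te α t *ᴹ N β) i j          ≈⟨ +-congˡ (*-congˡ (trans (exp-*ᴹ (N β) α t i j) (trans (+-congˡ (trans (*-congˡ αβ) (zeroʳ t))) (+-identityʳ _)))) ⟩
    exp-te α t i j + u * N β i j                          ≈⟨ +-congˡ (*-congˡ (trans (*ᴹ-exp (N β) α t i j) (trans (+-congˡ (trans (*-congˡ βα) (zeroʳ t))) (+-identityʳ _)))) ⟨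
    exp-te α t i j + u * (N β *ᴹ exp-te α t) i j          ≈⟨ exp-*ᴹ (exp-te α t) β u i j ⟨
    (exp-te β u *ᴹ exp-te α t) i j                        ∎
    where
    vanish : ∀ {y z} → y ≡ 0ℤ ⊎ z ≡ 0ℤ → fromℤ y * fromℤ z ≈ 0#
    vanish (inj₁ ≡.refl) = zeroˡ _
    vanish (inj₂ ≡.refl) = zeroʳ _
    αβ : (N α *ᴹ N β) i j ≈ 0#
    αβ = ∑-zero (λ k → N α i k * N β k j) λ k → vanish (proj₁ (zeros i k j))
    βα : (N β *ᴹ N α) i j ≈ 0#
    βα = ∑-zero (λ k → N β i k * N α k j) λ k → vanish (proj₂ (zeros i k j))

  -- The centraliser of three root elements.

  δ : Maybe (Fin 4) → Fin 4 → ℤ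
  δ (just i) k = ℤᴹ.1ᴹ i k
  δ nothing  k = 0ℤ

  pick : Maybe (Fin 4) → (Fin 4 → Carrier) → Carrier
  pick (just i) f = f i
  pick nothing  f = 0#

  ∑-δ : ∀ p (v : Fin 4 → ℤ) (f : Fin 4 → Carrier) → (∀ k → v k ≡ δ p k) → ∑[ k < 4 ] (fromℤ (v k) * f k) ≈ pick p f
  ∑-δ (just i) v f v≡ = trans (sum-cong-≋ λ k → *-congʳ {f k} (trans (reflexive (≡.cong fromℤ (v≡ k))) (fromℤ-1ᴹ k))) (∑-1ᴹˡ i f)
    where
    fromℤ-1ᴹ : ∀ k → fromℤ (ℤᴹ.1ᴹ i k) ≈ 1ᴹ i k
    fromℤ-1ᴹ k with does (i ≟ k)
    ... | true  = +-identityʳ 1#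
    ... | false = refl
  ∑-δ nothing v f v≡ = ∑-zero (λ k → fromℤ (v k) * f k) λ k →
    trans (*-congʳ (reflexive (≡.cong fromℤ (v≡ k)))) (zeroˡ _)

  -- p and q locate the nonzero entry (a 1), if any, in column j and in row i of N α.
  entry : ∀ {A} α → A *ᴹ N α ≋ N α *ᴹ A → ∀ i j p q →
    {True (all? λ k → (e° α k j ℤ.≟ δ p k) ×-dec (e° α i k ℤ.≟ δ q k))} →
    pick p (A i) ≈ pick q (λ k → A k j)
  entry {A} α comm i j p q {w} = begin
    pick p (A i)                  ≈⟨ ∑-δ p (λ k → e° α k j) (A i) (λ k → proj₁ (toWitness w k)) ⟨
    ∑[ k < 4 ] (N α k j * A i k)  ≈⟨ sum-cong-≋ (λ k → *-comm (N α k j) (A i k)) ⟩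
    (A *ᴹ N α) i j                ≈⟨ comm i j ⟩
    (N α *ᴹ A) i j                ≈⟨ ∑-δ q (e° α i) (λ k → A k j) (λ k → proj₂ (toWitness w k)) ⟩
    pick q (λ k → A k j)          ∎

  -- Commuting with `N 2e₂` and `N (⊝ 2e₂)` makes the middle block of A scalar and clears the rest
  -- of rows and columns 1 and 2. Commuting with `N e₁+e₂` equates the diagonal entries and clears
  -- the entry at (3 , 0), leaving only the one at (0 , 3) free.
  centraliser : ∀ A B → A *ᴹ B ≋ 1ᴹ →
    A *ᴹ N 2e₂ ≋ N 2e₂ *ᴹ A → A *ᴹ N (⊝ 2e₂) ≋ N (⊝ 2e₂) *ᴹ A → A *ᴹ N e₁+e₂ ≋ N e₁+e₂ *ᴹ A →
    ∃[ a ] ∃[ τ ] A ≋ a ·ᴹ exp-te 2e₁ τ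
  centraliser A B AB≈1 comm₁ comm₂ comm₃ = a , τ , shape
    where
    a τ : Carrier
    a = A 3F 3F
    -- The corner requires a τ = A 0F 3F. The last row of A is (0, 0, 0, a), so A B = 1 makes
    -- `B 3F 3F` the inverse of a.
    τ = B 3F 3F * A 0F 3F
    long⁺ = entry {A} 2e₂ comm₁
    long⁻ = entry {A} (⊝ 2e₂) comm₂
    short⁺ = entry {A} e₁+e₂ comm₃

    A₁₁≈a : A 1F 1F ≈ a
    A₁₁≈a = short⁺ 1F 3F (just 1F) (just 3F)
    A₂₂≈a : A 2F 2F ≈ a
    A₂₂≈a = trans (sym (long⁺ 1F 2F (just 1F) (just 2F))) A₁₁≈a
    A₃₀≈0 : A 3F 0F ≈ 0#
    A₃₀≈0 = short⁺ 3F 2F (just 0F) nothing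
    A₃₁≈0 : A 3F 1F ≈ 0#
    A₃₁≈0 = long⁺ 3F 2F (just 1F) nothing
    A₃₂≈0 : A 3F 2F ≈ 0#
    A₃₂≈0 = long⁻ 3F 1F (just 2F) nothing

    a*B₃₃≈1 : a * B 3F 3F ≈ 1#
    a*B₃₃≈1 = trans (sym (begin
      A 3F 0F * B 0F 3F + (A 3F 1F * B 1F 3F + (A 3F 2F * B 2F 3F + (a * B 3F 3F + 0#)))
        ≈⟨ +-cong (kill A₃₀≈0) (+-cong (kill A₃₁≈0) (+-cong (kill A₃₂≈0) (+-identityʳ _))) ⟩
      0# + (0# + (0# + a * B 3F 3F))
        ≈⟨ trans (+-identityˡ _) (trans (+-identityˡ _) (+-identityˡ _)) ⟩
      a * B 3F 3F ∎)) (AB≈1 3F 3F)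
      where
      kill : ∀ {y z} → y ≈ 0# → y * z ≈ 0#
      kill y≈0 = trans (*-congʳ y≈0) (zeroˡ _)

    open Solver using (solve; con; _:+_; _:*_; _:=_)
    -- The right-hand sides are the unfolded entries of `a ·ᴹ exp-te 2e₁ τ`; in the corner
    -- `fromℤ 1ℤ` unfolds to 1# + 0#.
    diagonal : ∀ {y} → y ≈ a → y ≈ a * (1# + τ * 0#)
    diagonal y≈a = trans y≈a (solve 2 (λ a τ → a := a :* (con 1 :+ τ :* con 0)) refl a τ)
    off-diagonal : ∀ {y} → y ≈ 0# → y ≈ a * (0# + τ * 0#)
    off-diagonal y≈0 = trans y≈0 (solve 2 (λ a τ → con 0 := a :* (con 0 :+ τ :* con 0)) refl a τ)
    corner : A 0F 3F ≈ a * (0# + τ * (1# + 0#))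
    corner = begin
      A 0F 3F                        ≈⟨ *-identityˡ _ ⟨
      1# * A 0F 3F                   ≈⟨ *-congʳ a*B₃₃≈1 ⟨
      a * B 3F 3F * A 0F 3F          ≈⟨ solve 3 (λ a b c → a :* b :* c := a :* (con 0 :+ b :* c :* (con 1 :+ con 0))) refl a (B 3F 3F) (A 0F 3F) ⟩
      a * (0# + τ * (1# + 0#))       ∎

    shape : A ≋ a ·ᴹ exp-te 2e₁ τ
    shape 0F 0F = diagonal (trans (short⁺ 0F 2F (just 0F) (just 2F)) A₂₂≈a)
    shape 0F 1F = off-diagonal (long⁺ 0F 2F (just 1F) nothing)
    shape 0F 2F = off-diagonal (long⁻ 0F 1F (just 2F) nothing)
    shape 0F 3F = corner
    shape 1F 0F = off-diagonal (sym (long⁻ 2F 0F nothing (just 1F)))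
    shape 1F 1F = diagonal A₁₁≈a
    shape 1F 2F = off-diagonal (long⁻ 1F 1F (just 2F) nothing)
    shape 1F 3F = off-diagonal (sym (long⁻ 2F 3F nothing (just 1F)))
    shape 2F 0F = off-diagonal (sym (long⁺ 1F 0F nothing (just 2F)))
    shape 2F 1F = off-diagonal (long⁺ 2F 2F (just 1F) nothing)
    shape 2F 2F = diagonal A₂₂≈a
    shape 2F 3F = off-diagonal (sym (long⁺ 1F 3F nothing (just 2F)))
    shape 3F 0F = off-diagonal A₃₀≈0
    shape 3F 1F = off-diagonal A₃₁≈0
    shape 3F 2F = off-diagonal A₃₂≈0
    shape 3F 3F = diagonal refl

  exp-cong : ∀ α {t u} → t ≈ u → exp-te α t ≋ exp-te α u
  exp-cong α t≈u i j = +-congˡ (*-congʳ t≈u)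

  *ᴹ-cong : ∀ {n} {A A′ B B′ : Matrix n} → A ≋ A′ → B ≋ B′ → A *ᴹ B ≋ A′ *ᴹ B′
  *ᴹ-cong {A = A} {A′} {B} {B′} A≋A′ B≋B′ i j = trans (*ᴹ-congʳ B A≋A′ i j) (*ᴹ-congˡ A′ B≋B′ i j)

  -- Transfer to an arbitrary Chevalley basis.

  module _ (𝓑 : ChevalleyBasis) where

    open Chevalley 𝓑 R using (x)
    open Solver using (solve; _:*_; _:=_)

    σ : Root → Carrier
    σ α = sgn (proj₁ (e-sign 𝓑 α))

    x-standard : ∀ α t → Chevalley.exp-te 𝓑 R α t ≋ exp-te α (σ α * t)
    x-standard α t i j = +-congˡ (begin
      t * fromℤ (ChevalleyBasis.e 𝓑 α i j)             ≡⟨ ≡.cong (λ z → t * fromℤ z) (proj₂ (e-sign 𝓑 α) i j) ⟩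
      t * fromℤ ((proj₁ (e-sign 𝓑 α) ◃ 1) ℤ.* e° α i j)  ≈⟨ *-congˡ (fromℤ-sign (proj₁ (e-sign 𝓑 α)) (e° α i j)) ⟩
      t * (σ α * fromℤ (e° α i j))                     ≈⟨ *-assoc t (σ α) _ ⟨
      t * σ α * fromℤ (e° α i j)                       ≈⟨ *-congʳ (*-comm t (σ α)) ⟩
      σ α * t * fromℤ (e° α i j)                       ∎)

    σ² : ∀ α → σ α * σ α ≈ 1#
    σ² α = sgn² (proj₁ (e-sign 𝓑 α))

    x-exp : ∀ α {t u} → σ α * t ≈ u → mat (x α t) ≋ exp-te α u
    x-exp α {t} σt≈u i j = trans (x-standard α t i j) (exp-cong α σt≈u i j)

    x₁-commutes-N : ∀ (g : Invertible 4) α → (g 𝔾.∙ x α 1#) 𝔾.≈ (x α 1# 𝔾.∙ g) → mat g *ᴹ N α ≋ N α *ᴹ mat g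
    x₁-commutes-N g α comm = commutes-N (mat g) α {σ α} (σ² α) λ i j →
      trans (sym (*ᴹ-congˡ (mat g) x₁ i j)) (trans (comm i j) (*ᴹ-congʳ (mat g) x₁ i j))
      where
      x₁ : mat (x α 1#) ≋ exp-te α (σ α)
      x₁ = x-exp α (*-identityʳ _)

    x-commute : ∀ α β →
      (∀ i k j → (e° α i k ≡ 0ℤ ⊎ e° β k j ≡ 0ℤ) × (e° β i k ≡ 0ℤ ⊎ e° α k j ≡ 0ℤ)) →
      ∀ t u → (x α t 𝔾.∙ x β u) 𝔾.≈ (x β u 𝔾.∙ x α t)
    x-commute α β zeros t u i j = begin
      (mat (x α t) *ᴹ mat (x β u)) i j  ≈⟨ *ᴹ-cong (x-exp α refl) (x-exp β refl) i j ⟩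
      (exp-te α _ *ᴹ exp-te β _) i j    ≈⟨ exp-commute α β zeros _ _ i j ⟩
      (exp-te β _ *ᴹ exp-te α _) i j    ≈⟨ *ᴹ-cong (x-exp β refl) (x-exp α refl) i j ⟨
      (mat (x β u) *ᴹ mat (x α t)) i j  ∎

    -- In the standard basis Y consists of the x_{e₁+e₂}(T) x_{2e₂}(sT).
    s conjugator-parameter : Carrier
    s = σ e₁+e₂ * σ 2e₂
    conjugator-parameter = σ e₂-e₁ * s

    -- The sign in its parameter cancels that of the root vector, so the matrix is `exp-te e₂-e₁ s`.
    conjugator : Invertible 4
    conjugator = x e₂-e₁ conjugator-parameter

    -- Only the parameters at e₁+e₂ have to be matched: by the choice of `s`, the parameter at 2e₂
    -- is then s times the former, as in the commutator formula.
    conjugation-x : ∀ {y : Invertible 4} {a τ t} → mat y ≋ a ·ᴹ exp-te 2e₁ τ →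
      σ e₁+e₂ * t ≈ m * s * τ →
      ((x e₁+e₂ t 𝔾.∙ x 2e₂ t) 𝔾.∙ (conjugator 𝔾.∙ y)) 𝔾.≈ (y 𝔾.∙ conjugator)
    conjugation-x {y} {a} {τ} {t} y≋ t≈ i j = begin
      (mat (x e₁+e₂ t) *ᴹ mat (x 2e₂ t) *ᴹ (mat conjugator *ᴹ mat y)) i j
        ≈⟨ *ᴹ-cong (*ᴹ-cong (x-exp e₁+e₂ t≈) (x-exp 2e₂ σt≈)) (*ᴹ-cong c≋ y≋) i j ⟩
      (exp-te e₁+e₂ (m * s * τ) *ᴹ exp-te 2e₂ (s * (m * s * τ)) *ᴹ
        (exp-te e₂-e₁ s *ᴹ (a ·ᴹ exp-te 2e₁ τ))) i j
        ≈⟨ conjugation a s τ i j ⟩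
      ((a ·ᴹ exp-te 2e₁ τ) *ᴹ exp-te e₂-e₁ s) i j
        ≈⟨ *ᴹ-cong y≋ c≋ i j ⟨
      (mat y *ᴹ mat conjugator) i j ∎
      where
      cancel : ∀ α z → σ α * (σ α * z) ≈ z
      cancel α z = trans (sym (*-assoc _ _ z)) (trans (*-congʳ (σ² α)) (*-identityˡ z))
      c≋ : mat conjugator ≋ exp-te e₂-e₁ s
      c≋ = x-exp e₂-e₁ (cancel e₂-e₁ s)
      σt≈ : σ 2e₂ * t ≈ s * (m * s * τ)
      σt≈ = begin
        σ 2e₂ * t                                ≈⟨ cancel e₁+e₂ _ ⟨
        σ e₁+e₂ * (σ e₁+e₂ * (σ 2e₂ * t))        ≈⟨ solve 3 (λ a b c → a :* (a :* (b :* c)) := a :* b :* (a :* c)) refl (σ e₁+e₂) (σ 2e₂) t ⟩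
        s * (σ e₁+e₂ * t)                        ≈⟨ *-congˡ t≈ ⟩
        s * (m * s * τ)                          ∎

    Centralises : Invertible 4 → Set ℓ
    Centralises y = ((y 𝔾.∙ x 2e₂ 1#) 𝔾.≈ (x 2e₂ 1# 𝔾.∙ y)) ×
      ((y 𝔾.∙ x (⊝ 2e₂) 1#) 𝔾.≈ (x (⊝ 2e₂) 1# 𝔾.∙ y)) ×
      ((y 𝔾.∙ x e₁+e₂ 1#) 𝔾.≈ (x e₁+e₂ 1# 𝔾.∙ y))

    -- The centraliser computation puts y in the form a x_{2e₁}(τ), so some z in Y satisfies z (c y)
    -- = y c = h (c y). Cancelling c y gives h = z.
    centralises⇒Y : ∀ h y → Centralises y → (h 𝔾.∙ (conjugator 𝔾.∙ y)) 𝔾.≈ (y 𝔾.∙ conjugator) → Y 𝓑 R h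
    centralises⇒Y h y (comm₁ , comm₂ , comm₃) h-conj =
      t , GroupProperties.∙-cancelʳ (GL 4) (conjugator 𝔾.∙ y) h (x e₁+e₂ t 𝔾.∙ x 2e₂ t)
      λ i j → trans (h-conj i j) (sym (conjugation-x {y} {a} {τ} {t} y≋ t≈ i j))
      where
      shape : ∃[ a ] ∃[ τ ] mat y ≋ a ·ᴹ exp-te 2e₁ τ
      shape = centraliser (mat y) (inv y) (mat*inv y)
        (x₁-commutes-N y 2e₂ comm₁) (x₁-commutes-N y (⊝ 2e₂) comm₂) (x₁-commutes-N y e₁+e₂ comm₃)
      a = proj₁ shape
      τ = proj₁ (proj₂ shape)
      y≋ = proj₂ (proj₂ shape)
      t = σ e₁+e₂ * (m * s * τ)
      t≈ : σ e₁+e₂ * t ≈ m * s * τ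
      t≈ = trans (sym (*-assoc _ _ _)) (trans (*-congʳ (σ² e₁+e₂)) (*-identityˡ _))

    -- The witness lies in the root subgroup of 2e₁, which commutes with those of ±2e₂ and e₁+e₂
    -- because the relevant products of root vectors vanish.
    Y⇒centralises : ∀ h → Y 𝓑 R h → ∃[ u ] Centralises (x 2e₁ u) ×
      (h 𝔾.∙ (conjugator 𝔾.∙ x 2e₁ u)) 𝔾.≈ (x 2e₁ u 𝔾.∙ conjugator)
    Y⇒centralises h (t , h≈) = u ,
      ( x-commute 2e₁ 2e₂ (commuting 2e₂) u 1#
      , x-commute 2e₁ (⊝ 2e₂) (commuting (⊝ 2e₂)) u 1#
      , x-commute 2e₁ e₁+e₂ (commuting e₁+e₂) u 1#) ,
      λ i j → trans (*ᴹ-congʳ (mat (conjugator 𝔾.∙ y)) h≈ i j)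
        (conjugation-x {y} {1#} {τ} {t} (λ i j → trans (x-exp 2e₁ σu≈τ i j) (sym (*-identityˡ _))) t≈ i j)
      where
      -- Solves m s τ = σ t for the sign σ of e₁+e₂, since m and s both square to 1.
      τ = m * s * (σ e₁+e₂ * t)
      u = σ 2e₁ * τ
      y = x 2e₁ u
      zeros? = λ β → all? λ i → all? λ k → all? λ j →
        (e° 2e₁ i k ℤ.≟ 0ℤ ⊎-dec e° β k j ℤ.≟ 0ℤ) ×-dec (e° β i k ℤ.≟ 0ℤ ⊎-dec e° 2e₁ k j ℤ.≟ 0ℤ)
      commuting : ∀ β → {True (zeros? β)} → _
      commuting β {w} = toWitness w
      σu≈τ : σ 2e₁ * u ≈ τ
      σu≈τ = trans (sym (*-assoc _ _ _)) (trans (*-congʳ (σ² 2e₁)) (*-identityˡ _))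
      t≈ : σ e₁+e₂ * t ≈ m * s * τ
      t≈ = begin
        w                               ≈⟨ trans (*-identityˡ _) (trans (*-identityˡ _) (*-identityˡ _)) ⟨
        1# * (1# * (1# * w))            ≈⟨ *-cong m² (*-cong (σ² e₁+e₂) (*-congʳ (σ² 2e₂))) ⟨
        m * m * (a * a * (b * b * w))   ≈⟨ solve 4 (λ m a b w → m :* m :* (a :* a :* (b :* b :* w)) := m :* (a :* b) :* (m :* (a :* b) :* w)) refl m a b w ⟩
        m * s * τ                       ∎
        where
        a = σ e₁+e₂
        b = σ 2e₂
        w = a * t

-- The system of equations defining Y in G.

proposition5 : ∀ {c ℓ p} (R : CommutativeRing c ℓ) → ¬ Has½ R →
    (𝓑 : ChevalleyBasis) (G : LargeSubgroup 𝓑 R p) →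
    Diophantine (LargeSubgroup.group G) (λ g → Y 𝓑 R (proj₁ g))
proposition5 R _ 𝓑 G = 1 , 4 , w , λ h → mk⇔ (to h) (from h)
  where
  open LargeSubgroup G using (large; group)
  open CommutativeRing R using (1#)
  open Chevalley 𝓑 R using (x)
  module 𝔾 = Group (Matrices.GL R 4)
  open GroupProperties group using (x∙y⁻¹≈ε⇒x≈y; x≈y⇒x∙y⁻¹≈ε)
  module G = Group group

  -- Largeness of G supplies both the constants of the words and the existential witness.
  xᴳ : Root → CommutativeRing.Carrier R → G.Carrier
  xᴳ α t = x α t , large (Generated.gen (α , t , 𝔾.refl {x α t}))

  cᴳ : G.Carrier
  cᴳ = xᴳ e₂-e₁ (conjugator-parameter R 𝓑)

  infix 6 _≐_
  _≐_ : ∀ {n} → Word G.Carrier n → Word G.Carrier n → Word G.Carrier n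
  v ≐ v′ = v · v′ ⁻¹

  -- `var 0F` is the element h under test and `var 1F` the witness y. Three words say that y lies in
  -- the centraliser; the last says h c y = y c, that is, h = [y , c].
  w : Fin 4 → Word G.Carrier 2
  w 0F = var 1F · const (xᴳ 2e₂ 1#) ≐ const (xᴳ 2e₂ 1#) · var 1F
  w 1F = var 1F · const (xᴳ (⊝ 2e₂) 1#) ≐ const (xᴳ (⊝ 2e₂) 1#) · var 1F
  w 2F = var 1F · const (xᴳ e₁+e₂ 1#) ≐ const (xᴳ e₁+e₂ 1#) · var 1F
  w 3F = var 0F · (const cᴳ · var 1F) ≐ var 1F · const cᴳ

  Solution : G.Carrier → Set _
  Solution h = Σ (Vector G.Carrier 1) λ y → ∀ i → evalWord group (w i) (h ∷ y) G.≈ G.ε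

  to : ∀ h → Y 𝓑 R (proj₁ h) → Solution h
  to h h∈Y = (λ _ → y) , λ where
      0F → x≈y⇒x∙y⁻¹≈ε {y G.∙ xᴳ 2e₂ 1#} {xᴳ 2e₂ 1# G.∙ y} (proj₁ comm)
      1F → x≈y⇒x∙y⁻¹≈ε {y G.∙ xᴳ (⊝ 2e₂) 1#} {xᴳ (⊝ 2e₂) 1# G.∙ y} (proj₁ (proj₂ comm))
      2F → x≈y⇒x∙y⁻¹≈ε {y G.∙ xᴳ e₁+e₂ 1#} {xᴳ e₁+e₂ 1# G.∙ y} (proj₂ (proj₂ comm))
      3F → x≈y⇒x∙y⁻¹≈ε {h G.∙ (cᴳ G.∙ y)} {y G.∙ cᴳ} (proj₂ (proj₂ solution))
    where
    solution = Y⇒centralises R 𝓑 (proj₁ h) h∈Y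
    y = xᴳ 2e₁ (proj₁ solution)
    comm = proj₁ (proj₂ solution)

  from : ∀ h → Solution h → Y 𝓑 R (proj₁ h)
  from h (ρ , eqs) = centralises⇒Y R 𝓑 (proj₁ h) (proj₁ y)
    ( x∙y⁻¹≈ε⇒x≈y (y G.∙ xᴳ 2e₂ 1#) (xᴳ 2e₂ 1# G.∙ y) (eqs 0F)
    , x∙y⁻¹≈ε⇒x≈y (y G.∙ xᴳ (⊝ 2e₂) 1#) (xᴳ (⊝ 2e₂) 1# G.∙ y) (eqs 1F)
    , x∙y⁻¹≈ε⇒x≈y (y G.∙ xᴳ e₁+e₂ 1#) (xᴳ e₁+e₂ 1# G.∙ y) (eqs 2F))
    (x∙y⁻¹≈ε⇒x≈y (h G.∙ (cᴳ G.∙ y)) (y G.∙ cᴳ) (eqs 3F))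
    where y = ρ 0F
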